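{- Let $(G,s,t)$ be an oriented serial superedge with principal subgraphs $(G_1,s_1,t_1),\dots,(G_k,s_k,t_k)$ (so $s_1=s$, $t_i=s_{i+1}$, $t_k=t$), each $G_i$ non-serial. For each $i$ let $\mathcal{T}_i\subseteq\mathsf{ST}(G_i)$ contain exactly one spanning tree from each orbit of $\mathsf{ST}(G_i)$ under $\mathrm{Aut}_{\mathrm{or}}(G_i,s_i,t_i)$. Then the set $\{T_1\cup\dots\cup T_k : T_i\in\mathcal{T}_i\text{ for }1\le i\le k\}$ consists of spanning trees of $G$ and contains exactly one spanning tree from each orbit of $\mathsf{ST}(G)$ under $\mathrm{Aut}_{\mathrm{or}}(G,s,t)$.
   Context: All graphs are finite, simple and undirected. An oriented series-parallel graph is a triple $(G,s,t)$ where $G$ is a graph and $s\neq t$ are vertices, defined recursively: (i) $G$ is a single edge with vertex set $\{s,t\}$; or (ii) (serial superedge) there are $k\ge 2$ oriented series-parallel graphs $(G_1,s_1,t_1),\dots,(G_k,s_k,t_k)$ with $s_1=s$, $t_k=t$, $t_i=s_{i+1}$ for $1\le i<k$, $V(G_i)\cap V(G_{i+1})=\{s_{i+1}\}$, $V(G_i)\cap V(G_j)=\emptyset$ for $|i-j|\ge2$, and $G=G_1\cup\dots\cup G_k$; or (iii) (parallel superedge) there are $k\ge2$ oriented series-parallel graphs $(G_1,s,t),\dots,(G_k,s,t)$ with $V(G_i)\cap V(G_j)=\{s,t\}$ for $i\neq j$ and $G=G_1\cup\dots\cup G_k$. The $G_i$ are the principal subgraphs. A graph is non-serial if it is not a serial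 superedge. For an oriented series-parallel graph $(H,u,v)$, $\mathrm{Aut}_{\mathrm{or}}(H,u,v)$ is the group of automorphisms of $H$ fixing $u$ and $v$, acting on subgraphs of $H$; $\mathsf{ST}(H)$ is the set of spanning trees of $H$. Two subgraphs $A,B$ are in the same orbit iff $A=\sigma(B)$ for some $\sigma$ in the group. -}

module Defs where

open import Data.Empty using (⊥-elim)
open import Data.Fin using (Fin; zero; suc; toℕ; fromℕ; inject₁)
open import Data.Fin.Permutation using (Permutation′; _⟨$⟩ʳ_; _⟨$⟩ˡ_)
open import Data.Fin.Subset
  using (Subset; _∈_; _∉_; _⊆_; _∪_; _∩_; ⁅_⁆; Nonempty) renaming (⊥ to ∅)
open import Data.Fin.Subset.Properties using (∉⊥; x∈p∪q⁻; x∈p∪q⁺)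
open import Data.Nat using (ℕ; suc; _+_; _≤_; ∣_-_∣)
open import Data.Product using (_×_; ∃; ∃!; ∃-syntax)
open import Data.Sum using () renaming (map to map⊎; [_,_] to [_,_]⊎)
open import Data.Vec using (lookup; tabulate)
open import Data.Vec.Functional using (foldr)
open import Data.Vec.Properties using (lookup∘tabulate; []=⇒lookup; lookup⇒[]=)
open import Function using (_∘_; _⇔_; Injective)
open import Level using (Level; 0ℓ)
open import Relation.Binary.Construct.Closure.ReflexiveTransitive using (Star)
open import Relation.Binary.PropositionalEquality
  using (_≡_; _≢_; sym; trans)
open import Relation.Nullary using (¬_)
open import Relation.Unary using (Pred)

private
  variable
    ℓ : Level
    n m k : ℕ

-- A finite simple graph whose vertices are drawn from the ambient set Fin n,
-- so that unions and intersections of graphs make sense; vertices may be a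
-- proper subset of Fin n.  nbr u is the set of neighbours of u.
record Graph (n : ℕ) : Set where
  field
    vertices   : Subset n
    nbr        : Fin n → Subset n
    nbr-sym    : ∀ {u v} → v ∈ nbr u → u ∈ nbr v
    nbr-irrefl : ∀ {u} → u ∉ nbr u
    nbr-vertex : ∀ {u v} → v ∈ nbr u → u ∈ vertices

  Adj : Fin n → Fin n → Set
  Adj u v = v ∈ nbr u

open Graph public

infix 4 _≈_ _⊑_

-- Equality of graphs; Graph also stores proofs, so _≡_ would be too fine.
_≈_ : Graph n → Graph n → Set
G ≈ H = vertices G ≡ vertices H × (∀ u → nbr G u ≡ nbr H u)

_⊑_ : Graph n → Graph n → Set
G ⊑ H = vertices G ⊆ vertices H × (∀ u → nbr G u ⊆ nbr H u)

emptyGraph : Graph n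
emptyGraph = record
  { vertices   = ∅
  ; nbr        = λ _ → ∅
  ; nbr-sym    = ⊥-elim ∘ ∉⊥
  ; nbr-irrefl = ∉⊥
  ; nbr-vertex = ⊥-elim ∘ ∉⊥
  }

infixr 6 _⊔ᴳ_

_⊔ᴳ_ : Graph n → Graph n → Graph n
G ⊔ᴳ H = record
  { vertices   = vertices G ∪ vertices H
  ; nbr        = λ u → nbr G u ∪ nbr H u
  ; nbr-sym    = λ {u} {v} → x∈p∪q⁺ ∘ map⊎ (nbr-sym G) (nbr-sym H)
                             ∘ x∈p∪q⁻ (nbr G u) (nbr H u)
  ; nbr-irrefl = λ {u} → [ nbr-irrefl G , nbr-irrefl H ]⊎
                         ∘ x∈p∪q⁻ (nbr G u) (nbr H u)
  ; nbr-vertex = λ {u} {v} → x∈p∪q⁺ ∘ map⊎ (nbr-vertex G) (nbr-vertex H)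
                             ∘ x∈p∪q⁻ (nbr G u) (nbr H u)
  }

⋃ᴳ : (Fin k → Graph n) → Graph n
⋃ᴳ = foldr _⊔ᴳ_ emptyGraph

-- Trees

Connected : Graph n → Set
Connected G = Nonempty (vertices G)
            × (∀ {u v} → u ∈ vertices G → v ∈ vertices G → Star (Adj G) u v)

-- A cycle of length 3 + m, given by its distinct vertices in cyclic order.
record Cycle (G : Graph n) (m : ℕ) : Set where
  field
    vertex    : Fin (3 + m) → Fin n
    injective : Injective _≡_ _≡_ vertex
    step      : ∀ (i : Fin (2 + m)) → Adj G (vertex (inject₁ i)) (vertex (suc i))
    close     : Adj G (vertex (fromℕ (2 + m))) (vertex zero)

IsTree : Graph n → Set
IsTree G = Connected G × (∀ m → ¬ Cycle G m)

record IsSpanningTree (G T : Graph n) : Set where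
  field
    subgraph : T ⊑ G
    spanning : vertices T ≡ vertices G
    tree     : IsTree T

ST : Graph n → Pred (Graph n) 0ℓ
ST G T = IsSpanningTree G T

-- Oriented series-parallel graphs

record Oriented (n : ℕ) : Set where
  field
    graph         : Graph n
    source        : Fin n
    target        : Fin n
    source∈       : source ∈ vertices graph
    target∈       : target ∈ vertices graph
    source≢target : source ≢ target

  V : Subset n
  V = vertices graph

open Oriented public

-- As graphs are simple, the two conditions determine graph G.
IsEdge : Oriented n → Set
IsEdge G = V G ≡ ⁅ source G ⁆ ∪ ⁅ target G ⁆ × Adj (graph G) (source G) (target G)

-- Both compositions have k = 2 + m ≥ 2 principal subgraphs.
record IsSerialComposition (G : Oriented n) (Gs : Fin (2 + m) → Oriented n) : Set where
  field
    first       : source (Gs zero) ≡ source G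
    last        : target (Gs (fromℕ (1 + m))) ≡ target G
    glue        : ∀ (i : Fin (1 + m)) → target (Gs (inject₁ i)) ≡ source (Gs (suc i))
    consecutive : ∀ (i : Fin (1 + m)) →
                  V (Gs (inject₁ i)) ∩ V (Gs (suc i)) ≡ ⁅ source (Gs (suc i)) ⁆
    distant     : ∀ i j → 2 ≤ ∣ toℕ i - toℕ j ∣ → V (Gs i) ∩ V (Gs j) ≡ ∅
    union       : graph G ≈ ⋃ᴳ (graph ∘ Gs)

record IsParallelComposition (G : Oriented n) (Gs : Fin (2 + m) → Oriented n) : Set where
  field
    sources : ∀ i → source (Gs i) ≡ source G
    targets : ∀ i → target (Gs i) ≡ target G
    meet    : ∀ {i j} → i ≢ j → V (Gs i) ∩ V (Gs j) ≡ ⁅ source G ⁆ ∪ ⁅ target G ⁆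
    union   : graph G ≈ ⋃ᴳ (graph ∘ Gs)

data SeriesParallel {n : ℕ} (G : Oriented n) : Set where
  edge     : IsEdge G → SeriesParallel G
  serial   : ∀ {m} (Gs : Fin (2 + m) → Oriented n) → (∀ i → SeriesParallel (Gs i)) →
             IsSerialComposition G Gs → SeriesParallel G
  parallel : ∀ {m} (Gs : Fin (2 + m) → Oriented n) → (∀ i → SeriesParallel (Gs i)) →
             IsParallelComposition G Gs → SeriesParallel G

SerialSuperedge : Oriented n → Set
SerialSuperedge {n} G =
  ∃[ m ] ∃ λ (Gs : Fin (2 + m) → Oriented n) →
    (∀ i → SeriesParallel (Gs i)) × IsSerialComposition G Gs

NonSerial : Oriented n → Set
NonSerial G = ¬ SerialSuperedge G

-- Automorphisms and orbits

-- Automorphisms of the graph fixing both terminals.  A permutation of V G is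
-- encoded as a permutation of Fin n that is the identity outside V G (hence
-- maps V G onto itself).
record Autₒᵣ (G : Oriented n) : Set where
  field
    perm          : Permutation′ n
    fixes-outside : ∀ {v} → v ∉ V G → perm ⟨$⟩ʳ v ≡ v
    preserves-adj : ∀ u v →
                    Adj (graph G) u v ⇔ Adj (graph G) (perm ⟨$⟩ʳ u) (perm ⟨$⟩ʳ v)
    fixes-source  : perm ⟨$⟩ʳ source G ≡ source G
    fixes-target  : perm ⟨$⟩ʳ target G ≡ target G

open Autₒᵣ public

image : Permutation′ n → Subset n → Subset n
image π p = tabulate (λ x → lookup p (π ⟨$⟩ˡ x))

∈image⁻ : ∀ (π : Permutation′ n) {p x} → x ∈ image π p → π ⟨$⟩ˡ x ∈ p
∈image⁻ π {p} {x} x∈ = lookup⇒[]= _ p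
  (trans (sym (lookup∘tabulate (λ y → lookup p (π ⟨$⟩ˡ y)) x)) ([]=⇒lookup x∈))

∈image⁺ : ∀ (π : Permutation′ n) {p x} → π ⟨$⟩ˡ x ∈ p → x ∈ image π p
∈image⁺ π {p} {x} x∈ = lookup⇒[]= x (image π p)
  (trans (lookup∘tabulate (λ y → lookup p (π ⟨$⟩ˡ y)) x) ([]=⇒lookup x∈))

infixr 7 _•_

_•_ : Permutation′ n → Graph n → Graph n
π • T = record
  { vertices   = image π (vertices T)
  ; nbr        = λ u → image π (nbr T (π ⟨$⟩ˡ u))
  ; nbr-sym    = ∈image⁺ π ∘ nbr-sym T ∘ ∈image⁻ π
  ; nbr-irrefl = nbr-irrefl T ∘ ∈image⁻ π
  ; nbr-vertex = ∈image⁺ π ∘ nbr-vertex T ∘ ∈image⁻ π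
  }

SameOrbit : Oriented n → Graph n → Graph n → Set
SameOrbit G A B = ∃ λ (σ : Autₒᵣ G) → A ≈ perm σ • B

ExactlyOnePerOrbit : Oriented n → Pred (Graph n) ℓ → Set ℓ
ExactlyOnePerOrbit G 𝒯 =
  ∀ A → ST (graph G) A → ∃! _≈_ (λ T → 𝒯 T × SameOrbit G T A)

Unions : (Fin k → Pred (Graph n) ℓ) → Pred (Graph n) ℓ
Unions {n = n} 𝒯 T =
  ∃ λ (Ts : Fin _ → Graph n) → (∀ i → 𝒯 i (Ts i)) × T ≈ ⋃ᴳ Ts

{-# OPTIONS --safe #-}
-- The cut vertices t₁, …, t₍ₖ₋₁₎ are the inner vertices meeting every walk from s to t:
-- inside a non-serial piece any inner vertex can be bypassed.  An automorphism fixing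
-- s and t therefore permutes them, and it does so monotonically, since tᵢ separates s
-- from tⱼ exactly when i < j; hence it fixes each tᵢ.  As every vertex of Gᵢ other than
-- tᵢ can be reached from s avoiding tᵢ, the automorphism then preserves G₁ ∪ … ∪ Gᵢ for
-- every i, and so every Gᵢ.  Thus Aut(G) is the product of the Aut(Gᵢ), compatibly with
-- the bijection A ↦ (A ∩ Gᵢ)ᵢ between spanning trees of G and families of spanning trees
-- of the Gᵢ.  The latter rests on the retraction of G onto Gᵢ that collapses the earlier
-- pieces to sᵢ and the later ones to tᵢ.

module Submission where

open import Defs
open import Data.Empty using (⊥; ⊥-elim)
open import Data.Fin using (Fin; zero; suc; toℕ; fromℕ; inject₁; _<_; _≤_)
open import Data.Fin.Induction using (<-weakInduction)
open import Data.Fin.Permutation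
  using (Permutation′; permutation; flip; inverseˡ; inverseʳ; _⟨$⟩ʳ_; _⟨$⟩ˡ_)
open import Data.Fin.Properties
  using (_≟_; any?; _<?_; <-cmp; ≤fromℕ; ≤∧≢⇒<; ≤-antisym; toℕ-injective; toℕ-inject₁;
         suc-injective; fromℕ≢inject₁; <⇒≢)
open import Data.Fin.Subset using (Subset; _∈_; _∉_; _∩_; ⁅_⁆)
  renaming (_⊆_ to _⊆ˢ_)
open import Data.Fin.Subset.Properties
  using (_∈?_; ∉⊥; x∈⁅y⁆⇒x≡y; x∈p∩q⁺; x∈p∩q⁻; x∈p∪q⁺; x∈p∪q⁻; ⊆-antisym; ⊆-reflexive)
open import Data.Nat using (ℕ; _+_; z≤n; s≤s; s≤s⁻¹; ∣_-_∣) renaming (_≤_ to _≤ⁿ_; _<_ to _<ⁿ_)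
import Data.Nat.Properties as ℕ
open import Data.Product using (_×_; _,_; ∃; ∃-syntax; proj₁; proj₂)
open import Data.Sum using (_⊎_; inj₁; inj₂; [_,_])
open import Data.Vec.Functional using () renaming (_∷_ to _∷ᶠ_)
open import Function using (_∘_; _⇔_; mk⇔; Equivalence; Injective)
open import Level using (Level; 0ℓ)
open import Relation.Binary using (Rel; tri<; tri≈; tri>)
open import Relation.Binary.Construct.Closure.ReflexiveTransitive
  using (Star; ε; _◅_; _◅◅_; gmap; reverse; kleisliStar) renaming (map to mapStar)
open import Relation.Binary.PropositionalEquality
  using (_≡_; _≢_; refl; sym; trans; cong; subst; subst₂; ≢-sym)
open import Relation.Nullary using (¬_; Dec; yes; no; contradiction)
open import Relation.Nullary.Decidable using (decidable-stable; _×-dec_)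
open import Relation.Unary using (Pred; _⊆_)

-- Equality, inclusion, intersection and union of graphs

private
  variable
    n m k : ℕ

-- These are stated for vertex sets and neighbourhood functions because a Graph
-- cannot be inferred from an unfolded _≈_ or _⊑_.
module _ {p q : Subset n} {f g : Fin n → Subset n} where

  ⊑-antisym : (p ⊆ˢ q × ∀ u → f u ⊆ˢ g u) → (q ⊆ˢ p × ∀ u → g u ⊆ˢ f u) →
              p ≡ q × ∀ u → f u ≡ g u
  ⊑-antisym (v , e) (v′ , e′) = ⊆-antisym v v′ , λ u → ⊆-antisym (e u) (e′ u)

  ≈⇒⊑ : (p ≡ q × ∀ u → f u ≡ g u) → p ⊆ˢ q × ∀ u → f u ⊆ˢ g u
  ≈⇒⊑ (v , e) = ⊆-reflexive v , λ u → ⊆-reflexive (e u)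

  ≈-sym : (p ≡ q × ∀ u → f u ≡ g u) → q ≡ p × ∀ u → g u ≡ f u
  ≈-sym (v , e) = sym v , λ u → sym (e u)

  ≈-trans : {r : Subset n} {h : Fin n → Subset n} → (p ≡ q × ∀ u → f u ≡ g u) →
            (q ≡ r × ∀ u → g u ≡ h u) → p ≡ r × ∀ u → f u ≡ h u
  ≈-trans (v , e) (v′ , e′) = trans v v′ , λ u → trans (e u) (e′ u)

adj-vertexʳ : (G : Graph n) {u v : Fin n} → Adj G u v → v ∈ vertices G
adj-vertexʳ G = nbr-vertex G ∘ nbr-sym G

infixr 7 _⊓ᴳ_

_⊓ᴳ_ : Graph n → Graph n → Graph n
G ⊓ᴳ H = record
  { vertices   = vertices G ∩ vertices H
  ; nbr        = λ u → nbr G u ∩ nbr H u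
  ; nbr-sym    = λ {u} {v} uv → let g , h = x∈p∩q⁻ (nbr G u) (nbr H u) uv
                                in x∈p∩q⁺ (nbr-sym G g , nbr-sym H h)
  ; nbr-irrefl = λ {u} uu → nbr-irrefl G (proj₁ (x∈p∩q⁻ (nbr G u) (nbr H u) uu))
  ; nbr-vertex = λ {u} {v} uv → let g , h = x∈p∩q⁻ (nbr G u) (nbr H u) uv
                                in x∈p∩q⁺ (nbr-vertex G g , nbr-vertex H h)
  }

module _ (G H : Graph n) where

  ⊓ᴳ-vertex⁻ : {v : Fin n} → v ∈ vertices (G ⊓ᴳ H) → v ∈ vertices G × v ∈ vertices H
  ⊓ᴳ-vertex⁻ = x∈p∩q⁻ (vertices G) (vertices H)

  ⊓ᴳ-adj⁻ : {u v : Fin n} → Adj (G ⊓ᴳ H) u v → Adj G u v × Adj H u v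
  ⊓ᴳ-adj⁻ {u} = x∈p∩q⁻ (nbr G u) (nbr H u)

  ⊓ᴳ⊑ˡ : (G ⊓ᴳ H) ⊑ G
  ⊓ᴳ⊑ˡ = proj₁ ∘ ⊓ᴳ-vertex⁻ , λ _ → proj₁ ∘ ⊓ᴳ-adj⁻

  ⊓ᴳ⊑ʳ : (G ⊓ᴳ H) ⊑ H
  ⊓ᴳ⊑ʳ = proj₂ ∘ ⊓ᴳ-vertex⁻ , λ _ → proj₂ ∘ ⊓ᴳ-adj⁻

⊓ᴳ-greatest : (G H K : Graph n) → K ⊑ G → K ⊑ H → K ⊑ (G ⊓ᴳ H)
⊓ᴳ-greatest G H K (v , e) (v′ , e′) =
  (λ x → x∈p∩q⁺ (v x , v′ x)) , λ u x → x∈p∩q⁺ (e u x , e′ u x)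

⊓ᴳ-congˡ : (G H K : Graph n) → G ≈ H → (G ⊓ᴳ K) ≈ (H ⊓ᴳ K)
⊓ᴳ-congˡ G H K (v , e) = cong (_∩ vertices K) v , λ u → cong (_∩ nbr K u) (e u)

⋃ᴳ-vertex⁻ : (Gs : Fin k → Graph n) {v : Fin n} →
             v ∈ vertices (⋃ᴳ Gs) → ∃[ i ] v ∈ vertices (Gs i)
⋃ᴳ-vertex⁻ {0}     Gs v∈ = ⊥-elim (∉⊥ v∈)
⋃ᴳ-vertex⁻ {ℕ.suc k} Gs v∈ with x∈p∪q⁻ (vertices (Gs zero)) _ v∈
... | inj₁ v∈₀ = zero , v∈₀
... | inj₂ v∈₊ = let i , v∈ᵢ = ⋃ᴳ-vertex⁻ (Gs ∘ suc) v∈₊ in suc i , v∈ᵢ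

⋃ᴳ-adj⁻ : (Gs : Fin k → Graph n) {u v : Fin n} → Adj (⋃ᴳ Gs) u v → ∃[ i ] Adj (Gs i) u v
⋃ᴳ-adj⁻ {0}     Gs uv = ⊥-elim (∉⊥ uv)
⋃ᴳ-adj⁻ {ℕ.suc k} Gs {u} uv with x∈p∪q⁻ (nbr (Gs zero) u) _ uv
... | inj₁ uv₀ = zero , uv₀
... | inj₂ uv₊ = let i , uvᵢ = ⋃ᴳ-adj⁻ (Gs ∘ suc) uv₊ in suc i , uvᵢ

⊑⋃ᴳ : (Gs : Fin k → Graph n) (i : Fin k) → Gs i ⊑ ⋃ᴳ Gs
⊑⋃ᴳ Gs zero    = x∈p∪q⁺ ∘ inj₁ , λ _ → x∈p∪q⁺ ∘ inj₁
⊑⋃ᴳ Gs (suc i) = let v , e = ⊑⋃ᴳ (Gs ∘ suc) i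
                 in x∈p∪q⁺ ∘ inj₂ ∘ v , λ u → x∈p∪q⁺ ∘ inj₂ ∘ e u

⋃ᴳ-least : (Gs : Fin k → Graph n) (G : Graph n) → (∀ i → Gs i ⊑ G) → ⋃ᴳ Gs ⊑ G
⋃ᴳ-least Gs G Gs⊑G =
  (λ v∈ → let i , v∈ᵢ = ⋃ᴳ-vertex⁻ Gs v∈ in proj₁ (Gs⊑G i) v∈ᵢ) ,
  (λ u uv → let i , uvᵢ = ⋃ᴳ-adj⁻ Gs uv in proj₂ (Gs⊑G i) u uvᵢ)

⋃ᴳ-mono : (Gs Hs : Fin k → Graph n) → (∀ i → Gs i ⊑ Hs i) → ⋃ᴳ Gs ⊑ ⋃ᴳ Hs
⋃ᴳ-mono Gs Hs Gs⊑Hs = ⋃ᴳ-least Gs (⋃ᴳ Hs) λ i →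
  let v , e = Gs⊑Hs i ; v′ , e′ = ⊑⋃ᴳ Hs i in v′ ∘ v , λ u → e′ u ∘ e u

⋃ᴳ-cong : (Gs Hs : Fin k → Graph n) → (∀ i → Gs i ≈ Hs i) → ⋃ᴳ Gs ≈ ⋃ᴳ Hs
⋃ᴳ-cong Gs Hs Gs≈Hs =
  ⊑-antisym (⋃ᴳ-mono Gs Hs (≈⇒⊑ ∘ Gs≈Hs)) (⋃ᴳ-mono Hs Gs (≈⇒⊑ ∘ ≈-sym ∘ Gs≈Hs))

-- Trees and cycles

connected-resp-≈ : (T U : Graph n) → T ≈ U → Connected T → Connected U
connected-resp-≈ T U T≈U ((x , x∈T) , walks) =
  (x , proj₁ T⊑U x∈T) ,
  λ u∈U v∈U → mapStar (λ {x} → proj₂ T⊑U x) (walks (proj₁ U⊑T u∈U) (proj₁ U⊑T v∈U))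
  where
    T⊑U = ≈⇒⊑ T≈U
    U⊑T = ≈⇒⊑ (≈-sym T≈U)

cycle-mono : (T U : Graph n) → T ⊑ U → Cycle T m → Cycle U m
cycle-mono T U (_ , e) c = record
  { vertex    = vertex
  ; injective = injective
  ; step      = λ i → e _ (step i)
  ; close     = e _ close
  }
  where open Cycle c

isTree-resp-≈ : (T U : Graph n) → T ≈ U → IsTree T → IsTree U
isTree-resp-≈ T U T≈U (conn , acyclic) =
  connected-resp-≈ T U T≈U conn , λ m → acyclic m ∘ cycle-mono U T (≈⇒⊑ (≈-sym T≈U))

isSpanningTree-resp-≈ : (G T U : Graph n) → T ≈ U →
                        IsSpanningTree G T → IsSpanningTree G U
isSpanningTree-resp-≈ G T U T≈U st = record
  { subgraph = let v , e = subgraph ; v′ , e′ = ≈⇒⊑ (≈-sym T≈U) in v ∘ v′ , λ u → e u ∘ e′ u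
  ; spanning = trans (sym (proj₁ T≈U)) spanning
  ; tree     = isTree-resp-≈ T U T≈U tree
  }
  where open IsSpanningTree st

-- Indexed in the same way as `Cycle`, so that a simple path with at least three vertices and
-- adjacent ends is already the data of a cycle.
record SimplePath (R : Rel (Fin n) 0ℓ) (x y : Fin n) : Set where
  field
    length    : ℕ
    vertex    : Fin (1 + length) → Fin n
    starts    : vertex zero ≡ x
    ends      : vertex (fromℕ length) ≡ y
    step      : ∀ (i : Fin length) → R (vertex (inject₁ i)) (vertex (suc i))
    injective : Injective _≡_ _≡_ vertex

module _ {R : Rel (Fin n) 0ℓ} where

  dropUntil : ∀ {l} (f : Fin (1 + l) → Fin n) →
              (∀ i → R (f (inject₁ i)) (f (suc i))) → Injective _≡_ _≡_ f →
              ∀ j → SimplePath R (f j) (f (fromℕ l))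
  dropUntil f step inj zero = record
    { vertex = f ; starts = refl ; ends = refl ; step = step ; injective = inj }
  dropUntil {ℕ.suc l} f step inj (suc j) =
    dropUntil (f ∘ suc) (step ∘ suc) (suc-injective ∘ inj) j

  prepend : ∀ {x y z} → R x y → (p : SimplePath R y z) →
            (∀ j → SimplePath.vertex p j ≢ x) → SimplePath R x z
  prepend {x} xy p x∉p = record
    { vertex    = x ∷ᶠ vertex
    ; starts    = refl
    ; ends      = ends
    ; step      = λ { zero → subst (R x) (sym starts) xy ; (suc i) → step i }
    ; injective = λ { {zero}  {zero}  _  → refl
                    ; {zero}  {suc j} eq → contradiction (sym eq) (x∉p j)
                    ; {suc i} {zero}  eq → contradiction eq (x∉p i)
                    ; {suc i} {suc j} eq → cong suc (injective eq) }
    }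
    where open SimplePath p

  loopErase : ∀ {x y} → Star R x y → SimplePath R x y
  loopErase {x} ε = record
    { length = 0 ; vertex = λ _ → x ; starts = refl ; ends = refl
    ; step = λ () ; injective = λ { {zero} {zero} _ → refl } }
  loopErase {x} (xy ◅ walk) with loopErase walk
  ... | p with any? (λ j → SimplePath.vertex p j ≟ x)
  ...   | no x∉p = prepend xy p λ j eq → x∉p (j , eq)
  -- The new first vertex already lies on the path, so the part of the path before it is cut away.
  ...   | yes (j , refl) = subst (SimplePath R x) (SimplePath.ends p)
                             (dropUntil vertex step injective j)
    where open SimplePath p

  walkAlong : ∀ {l} (f : Fin (1 + l) → Fin n) →
              (∀ i → R (f (inject₁ i)) (f (suc i))) → Star R (f zero) (f (fromℕ l))
  walkAlong {0}     f step = ε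
  walkAlong {ℕ.suc l} f step = step zero ◅ walkAlong (f ∘ suc) (step ∘ suc)

AdjMinus : Graph n → Fin n → Fin n → Rel (Fin n) 0ℓ
AdjMinus T a b x y = Adj T x y × ¬ (x ≡ a × y ≡ b) × ¬ (x ≡ b × y ≡ a)

-- A cycle amounts to an edge whose ends stay connected once that edge is deleted. Unlike `Cycle`,
-- this form asks for no injectivity, so it survives maps that identify vertices.
cycle⇒detour : {T : Graph n} → Cycle T m → ∃[ a ] ∃[ b ] Adj T a b × Star (AdjMinus T a b) b a
cycle⇒detour {m = m} c = _ , _ , close , walkAlong vertex λ i → step i ,
  (λ { (p , _) → fromℕ≢inject₁ (sym (injective p)) }) ,
  (λ { (p , q) → not-wrapping i (injective p) (injective q) })
  where
    open Cycle c
    -- No step is the closing edge reversed, because the cycle has at least three vertices.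
    not-wrapping : (i : Fin (2 + m)) → inject₁ i ≡ zero → suc i ≡ fromℕ (2 + m) → ⊥
    not-wrapping zero    _ ()
    not-wrapping (suc i) () _

-- After loop erasure, length 0 would make `ab` a loop and length 1 would use the deleted edge; any
-- longer path is closed up by `ab`.
detour⇒cycle : {T : Graph n} {a b : Fin n} →
               Adj T a b → Star (AdjMinus T a b) b a → ∃[ m ] Cycle T m
detour⇒cycle {T = T} {a} {b} ab detour = close-up (loopErase detour)
  where
    close-up : SimplePath (AdjMinus T a b) b a → ∃[ m ] Cycle T m
    close-up record { length = 0 ; starts = refl ; ends = refl } = ⊥-elim (nbr-irrefl T ab)
    close-up record { length = 1 ; starts = s ; ends = t ; step = step } =
      ⊥-elim (proj₂ (proj₂ (step zero)) (s , t))
    close-up record { length = ℕ.suc (ℕ.suc m) ; vertex = f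
                    ; starts = s ; ends = t ; step = step ; injective = inj } =
      m , record { vertex = f ; injective = inj ; step = proj₁ ∘ step
                 ; close = subst₂ (Adj T) (sym t) (sym s) ab }

-- Serial compositions

Within : Pred (Fin n) 0ℓ → Graph n → Rel (Fin n) 0ℓ
Within Q G u v = Adj G u v × Q u × Q v

within-mono : {Q : Pred (Fin n) 0ℓ} (G H : Graph n) → (∀ {u v} → Adj G u v → Adj H u v) →
              ∀ {u v} → Star (Within Q G) u v → Star (Within Q H) u v
within-mono _ _ e⊑ = mapStar λ (e , q , q′) → e⊑ e , q , q′

-- Quantifying over Q says that some walk from the source to v meets the target at most
-- in v, without deciding in advance which vertices a composition must avoid.
SourceReaches : Oriented n → Set₁
SourceReaches {n} H = ∀ {Q : Pred (Fin n) 0ℓ} {v} → v ∈ V H → Q v →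
  (∀ {u} → u ∈ V H → u ≢ target H → Q u) → Star (Within Q (graph H)) (source H) v

module Serial {G : Oriented n} {Gs : Fin (2 + m) → Oriented n}
              (isSerial : IsSerialComposition G Gs) where

  open IsSerialComposition isSerial

  src tgt : Fin (2 + m) → Fin n
  src = source ∘ Gs
  tgt = target ∘ Gs

  lastᶠ : Fin (2 + m)
  lastᶠ = fromℕ (1 + m)

  piece⊑ : ∀ i → graph (Gs i) ⊑ graph G
  piece⊑ i = let v , e = ⊑⋃ᴳ (graph ∘ Gs) i ; v′ , e′ = ≈⇒⊑ (≈-sym union)
             in v′ ∘ v , λ u → e′ u ∘ e u

  piece-of : ∀ {v} → v ∈ V G → ∃[ i ] v ∈ V (Gs i)
  piece-of = ⋃ᴳ-vertex⁻ (graph ∘ Gs) ∘ proj₁ (≈⇒⊑ union)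

  piece-of-edge : ∀ {u v} → Adj (graph G) u v → ∃[ i ] Adj (graph (Gs i)) u v
  piece-of-edge {u} = ⋃ᴳ-adj⁻ (graph ∘ Gs) ∘ proj₂ (≈⇒⊑ union) u

  -- Pieces at distance at least two are disjoint by `distant`; for neighbours, `consecutive` leaves
  -- only the source of the later one, which `glue` identifies with the target of the earlier one.
  shared : ∀ {i j v} → i < j → v ∈ V (Gs i) → v ∈ V (Gs j) →
            ℕ.suc (toℕ i) ≡ toℕ j × v ≡ tgt i × v ≡ src j
  shared {i} {suc j} {v} (s≤s i≤j) v∈i v∈j with toℕ i ℕ.≟ toℕ j
  ... | yes i≡j with refl ← toℕ-injective {i = i} {inject₁ j} (trans i≡j (sym (toℕ-inject₁ j))) =
    cong ℕ.suc i≡j , trans v≡src (sym (glue j)) , v≡src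
    where
      v≡src : v ≡ src (suc j)
      v≡src = x∈⁅y⁆⇒x≡y _ (subst (v ∈_) (consecutive j) (x∈p∩q⁺ (v∈i , v∈j)))
  ... | no i≢j = ⊥-elim (∉⊥ (subst (v ∈_) (distant i (suc j) far) (x∈p∩q⁺ (v∈i , v∈j))))
    where
      far : 2 ≤ⁿ ∣ toℕ i - ℕ.suc (toℕ j) ∣
      far = subst (2 ≤ⁿ_) (sym (ℕ.m≤n⇒∣m-n∣≡n∸m (ℕ.m≤n⇒m≤1+n i≤j)))
              (ℕ.m+n≤o⇒m≤o∸n 2 (s≤s (ℕ.≤∧≢⇒< i≤j i≢j)))

  shared-terminal : ∀ {i j v} → i ≢ j → v ∈ V (Gs i) → v ∈ V (Gs j) → v ≡ src i ⊎ v ≡ tgt i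
  shared-terminal {i} {j} i≢j v∈i v∈j with <-cmp i j
  ... | tri< i<j _ _ = inj₂ (proj₁ (proj₂ (shared i<j v∈i v∈j)))
  ... | tri≈ _ i≡j _ = contradiction i≡j i≢j
  ... | tri> _ _ j<i = inj₁ (proj₂ (proj₂ (shared j<i v∈j v∈i)))

  -- A vertex of piece `j` shared with an earlier piece is `src j`, which differs from `tgt j`.
  tgt∉later : ∀ {i j} → i < j → tgt j ∉ V (Gs i)
  tgt∉later {j = j} i<j t∈i =
    source≢target (Gs j) (sym (proj₂ (proj₂ (shared i<j t∈i (target∈ (Gs j))))))

  tgt-injective : ∀ {i j} → tgt i ≡ tgt j → i ≡ j
  tgt-injective {i} {j} eq with <-cmp i j
  ... | tri< i<j _ _ = contradiction (subst (_∈ V (Gs i)) eq (target∈ (Gs i))) (tgt∉later i<j)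
  ... | tri≈ _ i≡j _ = i≡j
  ... | tri> _ _ j<i = contradiction (subst (_∈ V (Gs j)) (sym eq) (target∈ (Gs j))) (tgt∉later j<i)

  target-in-last : ∀ {i} → target G ∈ V (Gs i) → i ≡ lastᶠ
  target-in-last {i} t∈i = decidable-stable (i ≟ lastᶠ) λ i≢last →
    tgt∉later (≤∧≢⇒< (≤fromℕ i) i≢last) (subst (_∈ V (Gs i)) (sym last) t∈i)

  -- With `j` strictly between, `i` and `l` are not consecutive, so by `shared` they have no common
  -- vertex.
  between : ∀ {i j l v} → i ≤ j → j ≤ l → v ∈ V (Gs i) → v ∈ V (Gs l) → v ∈ V (Gs j)
  between {i} {j} {l} {v} i≤j j≤l v∈i v∈l with i ≟ j | j ≟ l
  ... | yes refl | _        = v∈i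
  ... | no _     | yes refl = v∈l
  ... | no i≢j   | no j≢l   = contradiction
    (ℕ.≤-trans (s≤s (≤∧≢⇒< i≤j i≢j)) (≤∧≢⇒< j≤l j≢l))
    (ℕ.≤⇒≯ (ℕ.≤-reflexive (sym (proj₁ (shared (ℕ.≤-<-trans i≤j (≤∧≢⇒< j≤l j≢l)) v∈i v∈l)))))

  -- Distinct pieces share at most one vertex, so an edge with both ends in two of them would be a
  -- loop. Hence the edge sets are disjoint and every piece is an induced subgraph.
  edge-in-piece : ∀ {i j u v} → Adj (graph (Gs j)) u v → u ∈ V (Gs i) → v ∈ V (Gs i) → i ≡ j
  edge-in-piece {i} {j} uv u∈i v∈i with <-cmp i j
  ... | tri≈ _ i≡j _ = i≡j
  ... | tri< i<j _ _ = ⊥-elim (nbr-irrefl (graph (Gs j)) (subst (Adj (graph (Gs j)) _)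
    (trans (proj₁ (proj₂ (shared i<j v∈i (adj-vertexʳ (graph (Gs j)) uv))))
           (sym (proj₁ (proj₂ (shared i<j u∈i (nbr-vertex (graph (Gs j)) uv)))))) uv))
  ... | tri> _ _ j<i = ⊥-elim (nbr-irrefl (graph (Gs j)) (subst (Adj (graph (Gs j)) _)
    (trans (proj₁ (proj₂ (shared j<i (adj-vertexʳ (graph (Gs j)) uv) v∈i)))
           (sym (proj₁ (proj₂ (shared j<i (nbr-vertex (graph (Gs j)) uv) u∈i))))) uv))

  induced-adj : ∀ {i u v} → Adj (graph G) u v → u ∈ V (Gs i) → v ∈ V (Gs i) →
                Adj (graph (Gs i)) u v
  induced-adj uv u∈i v∈i with piece-of-edge uv
  ... | j , uvⱼ with refl ← edge-in-piece uvⱼ u∈i v∈i = uvⱼ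

  chain : ∀ {R : Rel (Fin n) 0ℓ} i → (∀ j → j < i → Star R (src j) (tgt j)) →
          Star R (source G) (src i)
  chain {R} = <-weakInduction P (λ _ → subst (Star R (source G)) (sym first) ε) λ i ih links →
    subst (Star R (source G)) (glue i)
      (ih (λ j j<i → links j (ℕ.<-trans j<i (inject₁<suc i))) ◅◅ links (inject₁ i) (inject₁<suc i))
    where
      P : Pred (Fin (2 + m)) 0ℓ
      P i = (∀ j → j < i → Star R (src j) (tgt j)) → Star R (source G) (src i)

      inject₁<suc : ∀ (i : Fin (1 + m)) → inject₁ i < suc i
      inject₁<suc i = s≤s (ℕ.≤-reflexive (toℕ-inject₁ i))

  traverse : ∀ {R : Rel (Fin n) 0ℓ} → (∀ j → Star R (src j) (tgt j)) →
             Star R (source G) (target G)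
  traverse {R} links =
    chain lastᶠ (λ j _ → links j) ◅◅ subst (Star R (src lastᶠ)) last (links lastᶠ)

  module _ (reaches : ∀ i → SourceReaches (Gs i)) where

    -- The earlier pieces are crossed from source to target, so `Q` is required on all of them;
    -- inside piece `i` the walk stops at `v` and need not pass `tgt i`.
    reach : ∀ {Q : Pred (Fin n) 0ℓ} {v} i → v ∈ V (Gs i) → Q v →
            (∀ {j u} → j < i → u ∈ V (Gs j) → Q u) →
            (∀ {u} → u ∈ V (Gs i) → u ≢ tgt i → Q u) → Star (Within Q (graph G)) (source G) v
    reach {Q} i v∈i Qv before at =
      chain i (λ j j<i → lift (reaches j (target∈ (Gs j)) (before j<i (target∈ (Gs j)))
                                (λ u∈j _ → before j<i u∈j)))
      ◅◅ lift (reaches i v∈i Qv at)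
      where
        lift : ∀ {j u v} → Star (Within Q (graph (Gs j))) u v → Star (Within Q (graph G)) u v
        lift {j} = within-mono (graph (Gs j)) (graph G) (proj₂ (piece⊑ j) _)

    sourceReaches : SourceReaches G
    sourceReaches {Q} v∈G Qv Q-inner =
      let i , v∈i = piece-of v∈G
      -- `target G` occurs only in the last piece, as the target of that piece. Earlier pieces
      -- therefore avoid it, and in piece `i` avoiding `tgt i` suffices.
      in reach i v∈i Qv
           (λ {j} {u} j<i u∈j → Q-inner (proj₁ (piece⊑ j) u∈j) λ u≡t →
             ℕ.<⇒≱ j<i (subst (i ≤_)
               (sym (target-in-last (subst (_∈ V (Gs j)) u≡t u∈j))) (≤fromℕ i)))
           (λ {u} u∈i u≢tᵢ → Q-inner (proj₁ (piece⊑ i) u∈i) λ u≡t →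
             u≢tᵢ (trans u≡t (trans (sym last)
               (cong tgt (sym (target-in-last (subst (_∈ V (Gs i)) u≡t u∈i)))))))

-- Walks in series-parallel graphs

seriesParallel⇒sourceReaches : {H : Oriented n} → SeriesParallel H → SourceReaches H
seriesParallel⇒sourceReaches {H = H} (edge (V≡ , st)) {Q} {v} v∈H Qv Q-inner
  with x∈p∪q⁻ ⁅ source H ⁆ _ (subst (v ∈_) V≡ v∈H)
... | inj₁ v∈s with refl ← x∈⁅y⁆⇒x≡y _ v∈s = ε
... | inj₂ v∈t with refl ← x∈⁅y⁆⇒x≡y _ v∈t =
  (st , Q-inner (source∈ H) (source≢target H) , Qv) ◅ ε
seriesParallel⇒sourceReaches (serial Hs sp isSerial) =
  Serial.sourceReaches isSerial λ i → seriesParallel⇒sourceReaches (sp i)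
seriesParallel⇒sourceReaches {H = H} (parallel Hs sp isParallel) {Q} v∈H Qv Q-inner =
  let i , v∈i = ⋃ᴳ-vertex⁻ (graph ∘ Hs) (proj₁ (≈⇒⊑ union) v∈H)
      v⊑ , e⊑ = ⊑⋃ᴳ (graph ∘ Hs) i
      v⊒ , e⊒ = ≈⇒⊑ (≈-sym union)
  in subst (λ s → Star _ s _) (sources i)
       (within-mono (graph (Hs i)) (graph H) (e⊒ _ ∘ e⊑ _)
         (seriesParallel⇒sourceReaches (sp i) v∈i Qv
           λ u∈i u≢tᵢ → Q-inner (v⊒ (v⊑ u∈i)) (u≢tᵢ ∘ λ u≡t → trans u≡t (sym (targets i)))))
  where open IsParallelComposition isParallel

-- Two parallel branches meet only in the terminals, so `w` misses one of the first two, and that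
-- branch is crossed instead.
nonSerial-bypass : {H : Oriented n} → SeriesParallel H → NonSerial H →
                   ∀ {w} → w ≢ source H → w ≢ target H →
                   Star (Within (_≢ w) (graph H)) (source H) (target H)
nonSerial-bypass (edge (_ , st)) _ w≢s w≢t = (st , ≢-sym w≢s , ≢-sym w≢t) ◅ ε
nonSerial-bypass (serial Hs sp isSerial) nonSerial = contradiction (_ , Hs , sp , isSerial) nonSerial
nonSerial-bypass {H = H} (parallel Hs sp isParallel) _ {w} w≢s w≢t = bypass (w ∈? V (Hs zero))
  where
    open IsParallelComposition isParallel

    through : ∀ i → w ∉ V (Hs i) → Star (Within (_≢ w) (graph H)) (source H) (target H)
    through i w∉i = subst₂ (Star _) (sources i) (targets i)
      (within-mono (graph (Hs i)) (graph H)
        (proj₂ (≈⇒⊑ (≈-sym union)) _ ∘ proj₂ (⊑⋃ᴳ (graph ∘ Hs) i) _)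
        (seriesParallel⇒sourceReaches (sp i) (target∈ (Hs i))
          (λ { refl → w∉i (target∈ (Hs i)) }) (λ { u∈i _ refl → w∉i u∈i })))

    bypass : Dec (w ∈ V (Hs zero)) → Star (Within (_≢ w) (graph H)) (source H) (target H)
    bypass (no w∉0)  = through zero w∉0
    bypass (yes w∈0) = through (suc zero) λ w∈1 →
      [ w≢s ∘ x∈⁅y⁆⇒x≡y _ , w≢t ∘ x∈⁅y⁆⇒x≡y _ ]
        (x∈p∪q⁻ ⁅ source H ⁆ _
          (subst (w ∈_) (meet {zero} {suc zero} λ ()) (x∈p∩q⁺ (w∈0 , w∈1))))

-- Automorphisms of a serial composition

⟨$⟩ʳ-injective : (π : Permutation′ n) → Injective _≡_ _≡_ (π ⟨$⟩ʳ_)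
⟨$⟩ʳ-injective π eq = trans (sym (inverseˡ π)) (trans (cong (π ⟨$⟩ˡ_) eq) (inverseˡ π))

module _ {G : Oriented n} where

  inverse : Autₒᵣ G → Autₒᵣ G
  inverse σ = record
    { perm          = flip π
    ; fixes-outside = λ v∉ → unmove (fixes-outside σ v∉)
    ; preserves-adj = λ u v → mk⇔
        (λ uv → Equivalence.from (preserves-adj σ _ _)
                  (subst₂ (Adj (graph G)) (sym (inverseʳ π)) (sym (inverseʳ π)) uv))
        (λ uv → subst₂ (Adj (graph G)) (inverseʳ π) (inverseʳ π)
                  (Equivalence.to (preserves-adj σ _ _) uv))
    ; fixes-source  = unmove (fixes-source σ)
    ; fixes-target  = unmove (fixes-target σ)
    }
    where
      π = perm σ
      unmove : ∀ {v} → π ⟨$⟩ʳ v ≡ v → π ⟨$⟩ˡ v ≡ v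
      unmove eq = trans (cong (π ⟨$⟩ˡ_) (sym eq)) (inverseˡ π)

  -- If the image of `v` were outside, it would be fixed, and injectivity would make it equal to
  -- `v`.
  preserves-V : (σ : Autₒᵣ G) → ∀ {v} → v ∈ V G → perm σ ⟨$⟩ʳ v ∈ V G
  preserves-V σ {v} v∈G with perm σ ⟨$⟩ʳ v ∈? V G
  ... | yes σv∈G = σv∈G
  ... | no σv∉G  = subst (_∈ V G) (sym (⟨$⟩ʳ-injective (perm σ) (fixes-outside σ σv∉G))) v∈G

  move-walk : (σ : Autₒᵣ G) → ∀ {w u v} → Star (Within (_≢ w) (graph G)) u v →
              Star (Within (_≢ perm σ ⟨$⟩ʳ w) (graph G)) (perm σ ⟨$⟩ʳ u) (perm σ ⟨$⟩ʳ v)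
  move-walk σ = gmap (perm σ ⟨$⟩ʳ_) λ (e , q , q′) →
    Equivalence.to (preserves-adj σ _ _) e , q ∘ inj , q′ ∘ inj
    where inj = ⟨$⟩ʳ-injective (perm σ)

strictlyMonotone⇒inflationary : (f : Fin k → Fin k) → (∀ {i j} → i < j → f i < f j) →
                                ∀ i → i ≤ f i
strictlyMonotone⇒inflationary {ℕ.suc k} f mono =
  <-weakInduction (λ i → i ≤ f i) z≤n λ i i≤fi →
    ℕ.≤-trans (s≤s (subst (_≤ⁿ toℕ (f (inject₁ i))) (toℕ-inject₁ i) i≤fi))
              (mono (s≤s (ℕ.≤-reflexive (toℕ-inject₁ i))))

module SerialAutomorphisms {G : Oriented n} {Gs : Fin (2 + m) → Oriented n}
         (sp : ∀ i → SeriesParallel (Gs i)) (isSerial : IsSerialComposition G Gs)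
         (nonSerial : ∀ i → NonSerial (Gs i)) where

  open IsSerialComposition isSerial using (first; last; glue)
  open Serial isSerial

  private
    reaches : ∀ i → SourceReaches (Gs i)
    reaches i = seriesParallel⇒sourceReaches (sp i)

    _within_ : Fin n → Fin (2 + m) → Set
    v within i = ∃[ j ] j ≤ i × v ∈ V (Gs j)

  source-within : ∀ i → source G within i
  source-within i = zero , z≤n , subst (_∈ V (Gs zero)) first (source∈ (Gs zero))

  -- The first edge leading out of the pieces up to `i` starts at a vertex shared by a piece `j ≤ i`
  -- and a piece `l > i`. By `shared` this forces `j = i` and the vertex is `tgt i`, which the walk
  -- avoids.
  separates : ∀ {i u v} → Star (Within (_≢ tgt i) (graph G)) u v → u within i → v within i
  separates ε u≤i = u≤i
  separates {i} ((uv , u≢t , _) ◅ walk) (j , j≤i , u∈j) with piece-of-edge uv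
  ... | l , uvₗ = separates walk (l , l≤i , adj-vertexʳ (graph (Gs l)) uvₗ)
    where
      l≤i : l ≤ i
      l≤i = ℕ.≮⇒≥ λ i<l →
        let j+1≡l , u≡tⱼ , _ = shared (ℕ.≤-<-trans j≤i i<l) u∈j (nbr-vertex (graph (Gs l)) uvₗ)
            j≡i = ≤-antisym j≤i (s≤s⁻¹ (subst (toℕ i <ⁿ_) (sym j+1≡l) i<l))
        in u≢t (trans u≡tⱼ (cong tgt j≡i))

  tgt-within : ∀ {i j} → tgt i within j → i ≤ j
  tgt-within (l , l≤j , tᵢ∈l) = ℕ.≮⇒≥ λ j<i → tgt∉later (ℕ.≤-<-trans l≤j j<i) tᵢ∈l

  source-tgt : ∀ i → tgt i ≢ source G
  source-tgt zero    eq = source≢target (Gs zero) (trans first (sym eq))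
  source-tgt (suc i) eq = tgt∉later (s≤s z≤n)
    (subst (_∈ V (Gs zero)) (trans first (sym eq)) (source∈ (Gs zero)))

  reach-avoiding : ∀ {i v w} → v ∈ V (Gs i) → v ≢ w →
                   (∀ {j u} → j ≤ i → u ∈ V (Gs j) → (j ≡ i → u ≢ tgt i) → u ≢ w) →
                   Star (Within (_≢ w) (graph G)) (source G) v
  reach-avoiding {i} v∈i v≢w avoid =
    reach reaches i v∈i v≢w
      (λ j<i u∈j → avoid (ℕ.<⇒≤ j<i) u∈j (⊥-elim ∘ <⇒≢ j<i))
      (λ u∈i u≢t → avoid ℕ.≤-refl u∈i λ _ → u≢t)

  module _ (σ : Autₒᵣ G) where

    private
      σ′ = inverse σ
      π  = perm σ

    -- Otherwise the image of `tgt i` is not a terminal of any piece and can be bypassed in each.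
    -- Pulling the resulting walk from source to target back along the inverse gives one avoiding
    -- `tgt i`, so `i` is last; but then `tgt i` is the fixed vertex `target G`.
    tgt↦tgt : ∀ i → ∃[ j ] π ⟨$⟩ʳ tgt i ≡ tgt j
    tgt↦tgt i with any? (λ j → π ⟨$⟩ʳ tgt i ≟ tgt j)
    ... | yes found = found
    ... | no none = contradiction
      (lastᶠ , trans (cong (π ⟨$⟩ʳ_) tᵢ≡t) (trans (fixes-target σ) (sym last))) none
      where
        w = π ⟨$⟩ʳ tgt i

        bypass : ∀ j → Star (Within (_≢ w) (graph (Gs j))) (src j) (tgt j)
        bypass j = nonSerial-bypass (sp j) (nonSerial j) (w≢src j) λ eq → none (j , eq)
          where
            w≢src : ∀ j → w ≢ src j
            w≢src zero    eq = source-tgt i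
              (⟨$⟩ʳ-injective π (trans eq (trans first (sym (fixes-source σ)))))
            w≢src (suc j) eq = none (inject₁ j , trans eq (sym (glue j)))

        walk : Star (Within (_≢ tgt i) (graph G)) (source G) (target G)
        walk = subst₂ (Star (Within (_≢ tgt i) (graph G))) (fixes-source σ′) (fixes-target σ′)
          (subst (λ x → Star (Within (_≢ x) (graph G)) _ _) (inverseˡ π)
            (move-walk σ′ (traverse λ j →
              within-mono (graph (Gs j)) (graph G) (proj₂ (piece⊑ j) _) (bypass j))))

        tᵢ≡t : tgt i ≡ target G
        tᵢ≡t = trans (cong tgt (≤-antisym (≤fromℕ i)
                 (tgt-within (subst (_within i) (sym last) (separates walk (source-within i))))))
                 last

    -- If the order were reversed, a walk from the source to `tgt q` avoiding `tgt p` would exist;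
    -- its preimage reaches `tgt j` while avoiding `tgt i`, against `separates`.
    tgt↦tgt-mono : ∀ {i j} → i < j → proj₁ (tgt↦tgt i) < proj₁ (tgt↦tgt j)
    tgt↦tgt-mono {i} {j} i<j with tgt↦tgt i | tgt↦tgt j
    ... | p , σtᵢ≡tₚ | q , σtⱼ≡t_q with <-cmp p q
    ... | tri< p<q _ _ = p<q
    ... | tri≈ _ refl _ = contradiction
      (tgt-injective (⟨$⟩ʳ-injective π (trans σtᵢ≡tₚ (sym σtⱼ≡t_q)))) (<⇒≢ i<j)
    ... | tri> _ _ q<p = contradiction (tgt-within (separates walk (source-within i))) (ℕ.<⇒≱ i<j)
      where
        walk : Star (Within (_≢ tgt i) (graph G)) (source G) (tgt j)
        walk = subst₂ (Star (Within (_≢ tgt i) (graph G))) (fixes-source σ′)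
          (trans (cong (π ⟨$⟩ˡ_) (sym σtⱼ≡t_q)) (inverseˡ π))
          (subst (λ x → Star (Within (_≢ x) (graph G)) (π ⟨$⟩ˡ source G) (π ⟨$⟩ˡ tgt q))
            (trans (cong (π ⟨$⟩ˡ_) (sym σtᵢ≡tₚ)) (inverseˡ π))
            (move-walk σ′ (reach-avoiding {q} (target∈ (Gs q))
              (λ eq → <⇒≢ q<p (tgt-injective eq))
              (λ { l≤q u∈l _ refl → tgt∉later (ℕ.≤-<-trans l≤q q<p) u∈l }))))

  -- The index maps of the automorphism and of its inverse are both strictly monotone, hence
  -- inflationary: `i ≤ p ≤ q`, and `q = i`.
  fixes-tgt : (σ : Autₒᵣ G) → ∀ i → perm σ ⟨$⟩ʳ tgt i ≡ tgt i
  fixes-tgt σ i =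
    let π = perm σ
        p , σtᵢ≡tₚ = tgt↦tgt σ i
        q , σ′tₚ≡t_q = tgt↦tgt (inverse σ) p
        q≡i = tgt-injective
                (trans (sym σ′tₚ≡t_q) (trans (cong (π ⟨$⟩ˡ_) (sym σtᵢ≡tₚ)) (inverseˡ π)))
        i≤p = strictlyMonotone⇒inflationary _ (tgt↦tgt-mono σ) i
        p≤q = strictlyMonotone⇒inflationary _ (tgt↦tgt-mono (inverse σ)) p
    in trans σtᵢ≡tₚ (cong tgt (≤-antisym (subst (p ≤_) q≡i p≤q) i≤p))

  fixes-src : (σ : Autₒᵣ G) → ∀ i → perm σ ⟨$⟩ʳ src i ≡ src i
  fixes-src σ zero    = subst (λ s → perm σ ⟨$⟩ʳ s ≡ s) (sym first) (fixes-source σ)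
  fixes-src σ (suc i) = subst (λ s → perm σ ⟨$⟩ʳ s ≡ s) (glue i) (fixes-tgt σ (inject₁ i))

  -- A vertex of piece `i` other than `tgt i` is reached from the source avoiding `tgt i`. Both are
  -- fixed, so the image walk avoids `tgt i` too and cannot leave the first pieces.
  preserves-within : (σ : Autₒᵣ G) → ∀ {i v} → v ∈ V (Gs i) → (perm σ ⟨$⟩ʳ v) within i
  preserves-within σ {i} {v} v∈i with v ≟ tgt i
  ... | yes refl = i , ℕ.≤-refl , subst (_∈ V (Gs i)) (sym (fixes-tgt σ i)) (target∈ (Gs i))
  ... | no v≢t   = separates
    (subst₂ (λ x u → Star (Within (_≢ x) (graph G)) u _) (fixes-tgt σ i) (fixes-source σ)
      (move-walk σ (reach-avoiding v∈i v≢t avoid)))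
    (source-within i)
    where
      avoid : ∀ {j u} → j ≤ i → u ∈ V (Gs j) → (j ≡ i → u ≢ tgt i) → u ≢ tgt i
      avoid {j} j≤i u∈j u≢t with j ≟ i
      ... | yes j≡i = u≢t j≡i
      ... | no j≢i  = λ { refl → tgt∉later (≤∧≢⇒< j≤i j≢i) u∈j }

  -- σ and σ⁻¹ both map the union of the first i pieces into itself.
  preserves-piece : (σ : Autₒᵣ G) → ∀ {i v} → v ∈ V (Gs i) → perm σ ⟨$⟩ʳ v ∈ V (Gs i)
  preserves-piece σ {i} {v} v∈i =
    let π = perm σ
        l , l≤i , σv∈l = preserves-within σ v∈i
        j , j≤l , v∈j  = preserves-within (inverse σ) σv∈l
    in stay l≤i σv∈l j≤l (subst (_∈ V (Gs j)) (inverseˡ π) v∈j)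
    where
      stay : ∀ {l j} → l ≤ i → perm σ ⟨$⟩ʳ v ∈ V (Gs l) → j ≤ l → v ∈ V (Gs j) →
             perm σ ⟨$⟩ʳ v ∈ V (Gs i)
      stay {l} l≤i σv∈l j≤l v∈j with l ≟ i
      ... | yes refl = σv∈l
      -- Now `v` lies in piece `i` and in the earlier piece `j`, so it is the fixed vertex `src i`.
      ... | no l≢i   = subst (_∈ V (Gs i)) (sym (trans (cong (perm σ ⟨$⟩ʳ_) v≡sᵢ)
                         (fixes-src σ i))) (source∈ (Gs i))
        where v≡sᵢ = proj₂ (proj₂ (shared (ℕ.≤-<-trans j≤l (≤∧≢⇒< l≤i l≢i)) v∈j v∈i))

-- Spanning trees of a serial composition

module Retraction {G : Oriented n} {Gs : Fin (2 + m) → Oriented n}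
                  (isSerial : IsSerialComposition G Gs) (i : Fin (2 + m)) where

  open Serial isSerial

  -- The last clause also catches vertices outside `G`; this is harmless, since only edges of `G`
  -- are ever projected.
  retract : Fin n → Fin n
  retract v with v ∈? V (Gs i) | any? (λ j → (j <? i) ×-dec (v ∈? V (Gs j)))
  ... | yes _ | _     = v
  ... | no _  | yes _ = src i
  ... | no _  | no _  = tgt i

  retract-id : ∀ {v} → v ∈ V (Gs i) → retract v ≡ v
  retract-id {v} v∈i with v ∈? V (Gs i)
  ... | yes _  = refl
  ... | no v∉i = contradiction v∈i v∉i

  retract-before : ∀ {l v} → l < i → v ∈ V (Gs l) → retract v ≡ src i
  retract-before {l} {v} l<i v∈l
    with v ∈? V (Gs i) | any? (λ j → (j <? i) ×-dec (v ∈? V (Gs j)))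
  ... | yes v∈i | _      = proj₂ (proj₂ (shared l<i v∈l v∈i))
  ... | no _    | yes _  = refl
  ... | no _    | no ¬before = contradiction (l , l<i , v∈l) ¬before

  retract-after : ∀ {l v} → i < l → v ∈ V (Gs l) → retract v ≡ tgt i
  retract-after {l} {v} i<l v∈l
    with v ∈? V (Gs i) | any? (λ j → (j <? i) ×-dec (v ∈? V (Gs j)))
  ... | yes v∈i | _    = proj₁ (proj₂ (shared i<l v∈i v∈l))
  ... | no _    | no _ = refl
  ... | no v∉i  | yes (j , j<i , v∈j) =
    contradiction (between (ℕ.<⇒≤ j<i) (ℕ.<⇒≤ i<l) v∈j v∈l) v∉i

  retract-collapses : ∀ {l u v} → l ≢ i → u ∈ V (Gs l) → v ∈ V (Gs l) → retract u ≡ retract v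
  retract-collapses {l} l≢i u∈l v∈l with <-cmp l i
  ... | tri< l<i _ _ = trans (retract-before l<i u∈l) (sym (retract-before l<i v∈l))
  ... | tri≈ _ l≡i _ = contradiction l≡i l≢i
  ... | tri> _ _ i<l = trans (retract-after i<l u∈l) (sym (retract-after i<l v∈l))

  -- An edge of piece `i` is kept, and an edge of any other piece shrinks to a point. The relations
  -- are left general to serve both walks in a tree and walks avoiding a deleted edge.
  retract-walk : {R S : Rel (Fin n) 0ℓ} → (∀ {x y} → R x y → Adj (graph G) x y) →
                 (∀ {x y} → R x y → Adj (graph (Gs i)) x y → S x y) →
                 ∀ {u v} → u ∈ V (Gs i) → v ∈ V (Gs i) → Star R u v → Star S u v
  retract-walk {R} {S} R⇒adj R⇒S u∈i v∈i walk =
    subst₂ (Star S) (retract-id u∈i) (retract-id v∈i) (kleisliStar retract project walk)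
    where
      project : ∀ {x y} → R x y → Star S (retract x) (retract y)
      project xy with piece-of-edge (R⇒adj xy)
      ... | l , xyₗ with l ≟ i
      ...   | yes refl = subst₂ S (sym (retract-id (nbr-vertex (graph (Gs i)) xyₗ)))
                           (sym (retract-id (adj-vertexʳ (graph (Gs i)) xyₗ))) (R⇒S xy xyₗ) ◅ ε
      ...   | no l≢i   = subst (Star S _) (retract-collapses l≢i
                           (nbr-vertex (graph (Gs l)) xyₗ) (adj-vertexʳ (graph (Gs l)) xyₗ)) ε

module SerialTrees {G : Oriented n} {Gs : Fin (2 + m) → Oriented n}
                   (isSerial : IsSerialComposition G Gs) where

  open Serial isSerial
  open IsSpanningTree

  decompose : (A : Graph n) → A ⊑ graph G → A ≈ ⋃ᴳ (λ i → A ⊓ᴳ graph (Gs i))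
  decompose A (v⊑ , e⊑) = ⊑-antisym
    ( (λ {v} v∈A → let i , v∈i = piece-of (v⊑ v∈A) in proj₁ (⊑⋃ᴳ Aᵢ i) (x∈p∩q⁺ (v∈A , v∈i)))
    , (λ u uv → let i , uvᵢ = piece-of-edge (e⊑ u uv) in proj₂ (⊑⋃ᴳ Aᵢ i) u (x∈p∩q⁺ (uv , uvᵢ))))
    (⋃ᴳ-least Aᵢ A λ i → ⊓ᴳ⊑ˡ A (graph (Gs i)))
    where
      Aᵢ : Fin (2 + m) → Graph n
      Aᵢ i = A ⊓ᴳ graph (Gs i)

  -- Connectedness comes from retracting walks of `A` onto the piece; acyclicity is inherited by
  -- subgraphs.
  piece-isSpanningTree : {A : Graph n} → ST (graph G) A → ∀ i →
                         ST (graph (Gs i)) (A ⊓ᴳ graph (Gs i))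
  piece-isSpanningTree {A} st i = record
    { subgraph = ⊓ᴳ⊑ʳ A Gᵢ
    ; spanning = ⊆-antisym (proj₁ (⊓ᴳ⊑ʳ A Gᵢ)) λ v∈i → x∈p∩q⁺ (∈A v∈i , v∈i)
    ; tree     =
      ( (src i , x∈p∩q⁺ (∈A (source∈ (Gs i)) , source∈ (Gs i)))
      , λ u∈ v∈ → retract-walk (proj₂ (subgraph st) _) (λ xy xyᵢ → x∈p∩q⁺ (xy , xyᵢ))
          (proj₂ (⊓ᴳ-vertex⁻ A Gᵢ u∈)) (proj₂ (⊓ᴳ-vertex⁻ A Gᵢ v∈))
          (proj₂ (proj₁ (tree st)) (proj₁ (⊓ᴳ-vertex⁻ A Gᵢ u∈)) (proj₁ (⊓ᴳ-vertex⁻ A Gᵢ v∈))))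
      , λ m → proj₂ (tree st) m ∘ cycle-mono (A ⊓ᴳ Gᵢ) A (⊓ᴳ⊑ˡ A Gᵢ)
    }
    where
      open Retraction isSerial i
      Gᵢ = graph (Gs i)

      ∈A : ∀ {v} → v ∈ V (Gs i) → v ∈ vertices A
      ∈A {v} v∈i = subst (v ∈_) (sym (spanning st)) (proj₁ (piece⊑ i) v∈i)

  module _ {Ts : Fin (2 + m) → Graph n} (sts : ∀ i → ST (graph (Gs i)) (Ts i)) where

    private
      U = ⋃ᴳ Ts

      ∈T : ∀ {i v} → v ∈ V (Gs i) → v ∈ vertices (Ts i)
      ∈T {i} {v} v∈i = subst (v ∈_) (sym (spanning (sts i))) v∈i

      U⊑G : U ⊑ graph G
      U⊑G = ⋃ᴳ-least Ts (graph G) λ i →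
        let v , e = subgraph (sts i) ; v′ , e′ = piece⊑ i in v′ ∘ v , λ u → e′ u ∘ e u

      G⊆U : ∀ {v} → v ∈ V G → v ∈ vertices U
      G⊆U v∈G = let i , v∈i = piece-of v∈G in proj₁ (⊑⋃ᴳ Ts i) (∈T v∈i)

    union-adj : ∀ {i u v} → Adj U u v → Adj (graph (Gs i)) u v → Adj (Ts i) u v
    union-adj {i} {u} uv uvᵢ with ⋃ᴳ-adj⁻ Ts uv
    ... | j , uvⱼ with refl ← edge-in-piece (proj₂ (subgraph (sts j)) u uvⱼ)
                          (nbr-vertex (graph (Gs i)) uvᵢ) (adj-vertexʳ (graph (Gs i)) uvᵢ) = uvⱼ

    -- Together with `decompose`, this makes union and intersection with the pieces mutually inverse
    -- on spanning trees.
    union-⊓ : ∀ i → (U ⊓ᴳ graph (Gs i)) ≈ Ts i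
    union-⊓ i = ⊑-antisym
      ( ∈T ∘ proj₂ ∘ ⊓ᴳ-vertex⁻ U Gᵢ
      , λ u uv → let uv∪ , uvᵢ = ⊓ᴳ-adj⁻ U Gᵢ uv in union-adj uv∪ uvᵢ)
      (⊓ᴳ-greatest U Gᵢ (Ts i) (⊑⋃ᴳ Ts i) (subgraph (sts i)))
      where Gᵢ = graph (Gs i)

    union-isSpanningTree : ST (graph G) U
    union-isSpanningTree = record
      { subgraph = U⊑G
      ; spanning = ⊆-antisym (proj₁ U⊑G) G⊆U
      ; tree     =
        ( (source G , G⊆U (source∈ G))
        , λ u∈ v∈ → reverse (nbr-sym U) (from-source (proj₁ U⊑G u∈)) ◅◅ from-source (proj₁ U⊑G v∈))
        , acyclic
      }
      where
        walk-in : ∀ {i u v} → u ∈ V (Gs i) → v ∈ V (Gs i) → Star (Adj U) u v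
        walk-in {i} u∈i v∈i = mapStar (λ {x} → proj₂ (⊑⋃ᴳ Ts i) x)
          (proj₂ (proj₁ (tree (sts i))) (∈T u∈i) (∈T v∈i))

        from-source : ∀ {v} → v ∈ V G → Star (Adj U) (source G) v
        from-source v∈G =
          let i , v∈i = piece-of v∈G
          in chain i (λ j _ → walk-in (source∈ (Gs j)) (target∈ (Gs j))) ◅◅ walk-in (source∈ (Gs i)) v∈i

        -- Retracting the cycle onto the piece containing one of its edges keeps that
        -- edge and turns the rest of the cycle into a walk avoiding it.
        acyclic : ∀ l → ¬ Cycle U l
        acyclic l c with cycle⇒detour c
        ... | a , b , ab , detour with ⋃ᴳ-adj⁻ Ts ab
        ... | i , abᵢ = let l′ , c′ = detour⇒cycle abᵢ detourᵢ in proj₂ (tree (sts i)) l′ c′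
          where
            open Retraction isSerial i
            Tᵢ⊆Gᵢ = proj₁ (subgraph (sts i))

            detourᵢ : Star (AdjMinus (Ts i) a b) b a
            detourᵢ = retract-walk (proj₂ U⊑G _ ∘ proj₁)
              (λ (xy , avoids) xyᵢ → union-adj xy xyᵢ , avoids)
              (Tᵢ⊆Gᵢ (adj-vertexʳ (Ts i) abᵢ)) (Tᵢ⊆Gᵢ (nbr-vertex (Ts i) abᵢ)) detour

-- Gluing and restricting automorphisms

module Glue (S : Fin k → Subset n) where

  Compatible : (Fin k → Fin n → Fin n) → Set
  Compatible f = (∀ i {v} → v ∈ S i → f i v ∈ S i)
               × (∀ i j {v} → v ∈ S i → v ∈ S j → f i v ≡ f j v)

  -- Uses whichever set containing `v` the search finds; `Compatible` makes the choice immaterial.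
  glued : (Fin k → Fin n → Fin n) → Fin n → Fin n
  glued f v with any? (λ i → v ∈? S i)
  ... | yes (i , _) = f i v
  ... | no _        = v

  glued-outside : ∀ f {v} → (∀ i → v ∉ S i) → glued f v ≡ v
  glued-outside f {v} v∉S with any? (λ i → v ∈? S i)
  ... | yes (i , v∈i) = contradiction v∈i (v∉S i)
  ... | no _          = refl

  glued-on : ∀ {f} → Compatible f → ∀ i {v} → v ∈ S i → glued f v ≡ f i v
  glued-on (_ , agree) i {v} v∈i with any? (λ i → v ∈? S i)
  ... | yes (j , v∈j) = agree j i v∈j v∈i
  ... | no v∉S        = contradiction (i , v∈i) v∉S

  glued-inverse : ∀ {f g} → Compatible f → Compatible g → (∀ i v → f i (g i v) ≡ v) →
                  ∀ v → glued f (glued g v) ≡ v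
  glued-inverse {f} {g} cf cg fg v with any? (λ i → v ∈? S i)
  ... | yes (i , v∈i) = trans (glued-on cf i (proj₁ cg i v∈i)) (fg i v)
  ... | no v∉S        = glued-outside f λ i v∈i → v∉S (i , v∈i)

  gluedPerm : (π : Fin k → Permutation′ n) →
              Compatible (λ i → π i ⟨$⟩ʳ_) → Compatible (λ i → π i ⟨$⟩ˡ_) → Permutation′ n
  gluedPerm π c c⁻¹ = permutation (glued (λ i → π i ⟨$⟩ʳ_)) (glued (λ i → π i ⟨$⟩ˡ_))
    (glued-inverse c c⁻¹ λ i _ → inverseʳ (π i)) (glued-inverse c⁻¹ c λ i _ → inverseˡ (π i))

module _ {G : Oriented n} where

  mkAut : (π : Permutation′ n) → (∀ {v} → v ∉ V G → π ⟨$⟩ʳ v ≡ v) →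
          (∀ {u v} → Adj (graph G) u v → Adj (graph G) (π ⟨$⟩ʳ u) (π ⟨$⟩ʳ v)) →
          (∀ {u v} → Adj (graph G) u v → Adj (graph G) (π ⟨$⟩ˡ u) (π ⟨$⟩ˡ v)) →
          π ⟨$⟩ʳ source G ≡ source G → π ⟨$⟩ʳ target G ≡ target G → Autₒᵣ G
  mkAut π outside forward backward s t = record
    { perm          = π
    ; fixes-outside = outside
    ; preserves-adj = λ u v →
        mk⇔ forward (subst₂ (Adj (graph G)) (inverseˡ π) (inverseˡ π) ∘ backward)
    ; fixes-source  = s
    ; fixes-target  = t
    }

  -- Stated for preimages under σ and ρ since _•_ tests membership on preimages.
  •-⊓ : (σ : Permutation′ n) (ρ : Autₒᵣ G) (A : Graph n) →
        (∀ {v} → v ∈ V G → σ ⟨$⟩ˡ v ≡ perm ρ ⟨$⟩ˡ v) →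
        ((σ • A) ⊓ᴳ graph G) ≈ perm ρ • (A ⊓ᴳ graph G)
  •-⊓ σ ρ A agree = ⊑-antisym
    ( (λ v∈ → let v∈σA , v∈G = ⊓ᴳ-vertex⁻ (σ • A) (graph G) v∈
              in ∈image⁺ π (x∈p∩q⁺ ( subst (_∈ vertices A) (agree v∈G) (∈image⁻ σ v∈σA)
                                    , preserves-V (inverse ρ) v∈G)))
    , (λ u uv → let uv∈σA , uv∈G = ⊓ᴳ-adj⁻ (σ • A) (graph G) uv
                in ∈image⁺ π (x∈p∩q⁺
                  ( subst₂ (Adj A) (agree (nbr-vertex (graph G) uv∈G))
                      (agree (adj-vertexʳ (graph G) uv∈G)) (∈image⁻ σ uv∈σA)
                  , Equivalence.to (preserves-adj (inverse ρ) _ _) uv∈G))))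
    ( (λ v∈ → let v∈A , v∈G′ = ⊓ᴳ-vertex⁻ A (graph G) (∈image⁻ π v∈)
                  v∈G = subst (_∈ V G) (inverseʳ π) (preserves-V ρ v∈G′)
              in x∈p∩q⁺ (∈image⁺ σ (subst (_∈ vertices A) (sym (agree v∈G)) v∈A) , v∈G))
    , (λ u uv → let uv∈A , uv∈G′ = ⊓ᴳ-adj⁻ A (graph G) (∈image⁻ π uv)
                    uv∈G = Equivalence.from (preserves-adj (inverse ρ) _ _) uv∈G′
                in x∈p∩q⁺
                  ( ∈image⁺ σ (subst₂ (Adj A) (sym (agree (nbr-vertex (graph G) uv∈G)))
                      (sym (agree (adj-vertexʳ (graph G) uv∈G))) uv∈A)
                  , uv∈G)))
    where π = perm ρ

  •-⊑ : (σ : Autₒᵣ G) (A : Graph n) → A ⊑ graph G → perm σ • A ⊑ graph G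
  •-⊑ σ A (v⊑ , e⊑) =
    (λ v∈ → subst (_∈ V G) (inverseʳ π) (preserves-V σ (v⊑ (∈image⁻ π v∈)))) ,
    (λ u uv → Equivalence.from (preserves-adj (inverse σ) _ _) (e⊑ _ (∈image⁻ π uv)))
    where π = perm σ

module GlueAutomorphisms {G : Oriented n} {Gs : Fin (2 + m) → Oriented n}
         (isSerial : IsSerialComposition G Gs) (σs : ∀ i → Autₒᵣ (Gs i)) where

  open IsSerialComposition isSerial using (first; last)
  open Serial isSerial
  open Glue (V ∘ Gs)

  private
    -- A vertex shared by two pieces is a terminal of both and so is fixed by both automorphisms.
    -- The family is a parameter because the inverses must be glued as well.
    compatible : (τs : ∀ i → Autₒᵣ (Gs i)) → Compatible (λ i → perm (τs i) ⟨$⟩ʳ_)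
    compatible τs = (λ i → preserves-V (τs i)) , agree
      where
        fixes : ∀ i {v} → v ≡ src i ⊎ v ≡ tgt i → perm (τs i) ⟨$⟩ʳ v ≡ v
        fixes i (inj₁ refl) = fixes-source (τs i)
        fixes i (inj₂ refl) = fixes-target (τs i)

        agree : ∀ i j {v} → v ∈ V (Gs i) → v ∈ V (Gs j) → perm (τs i) ⟨$⟩ʳ v ≡ perm (τs j) ⟨$⟩ʳ v
        agree i j v∈i v∈j with i ≟ j
        ... | yes refl = refl
        ... | no i≢j   = trans (fixes i (shared-terminal i≢j v∈i v∈j))
                           (sym (fixes j (shared-terminal (≢-sym i≢j) v∈j v∈i)))

    glued-adj : (τs : ∀ i → Autₒᵣ (Gs i)) → let f = glued (λ i → perm (τs i) ⟨$⟩ʳ_) in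
                ∀ {u v} → Adj (graph G) u v → Adj (graph G) (f u) (f v)
    glued-adj τs uv with piece-of-edge uv
    ... | i , uvᵢ = subst₂ (Adj (graph G))
      (sym (glued-on (compatible τs) i (nbr-vertex (graph (Gs i)) uvᵢ)))
      (sym (glued-on (compatible τs) i (adj-vertexʳ (graph (Gs i)) uvᵢ)))
      (proj₂ (piece⊑ i) _ (Equivalence.to (preserves-adj (τs i) _ _) uvᵢ))

  gluedAut : Autₒᵣ G
  gluedAut = mkAut (gluedPerm (perm ∘ σs) (compatible σs) (compatible (inverse ∘ σs)))
    (λ v∉G → glued-outside _ λ i v∈i → v∉G (proj₁ (piece⊑ i) v∈i))
    (glued-adj σs) (glued-adj (inverse ∘ σs))
    (subst (λ s → glued _ s ≡ s) first
      (trans (glued-on (compatible σs) zero (source∈ (Gs zero))) (fixes-source (σs zero))))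
    (subst (λ t → glued _ t ≡ t) last
      (trans (glued-on (compatible σs) lastᶠ (target∈ (Gs lastᶠ))) (fixes-target (σs lastᶠ))))

  gluedAut-on : ∀ i {v} → v ∈ V (Gs i) → perm gluedAut ⟨$⟩ˡ v ≡ perm (σs i) ⟨$⟩ˡ v
  -- By construction, the inverse of the glued permutation is the gluing of the inverses.
  gluedAut-on = glued-on (compatible (inverse ∘ σs))

module RestrictAutomorphism {G : Oriented n} {Gs : Fin (2 + m) → Oriented n}
         (sp : ∀ i → SeriesParallel (Gs i)) (isSerial : IsSerialComposition G Gs)
         (nonSerial : ∀ i → NonSerial (Gs i)) (σ : Autₒᵣ G) (i : Fin (2 + m)) where

  open Serial isSerial
  open SerialAutomorphisms sp isSerial nonSerial
  -- Restriction is gluing with a single set: the automorphism on the piece, the identity elsewhere.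
  open Glue {k = 1} (λ _ → V (Gs i))

  private
    compatible : (τ : Autₒᵣ G) → Compatible (λ _ → perm τ ⟨$⟩ʳ_)
    compatible τ = (λ _ → preserves-piece τ) , λ _ _ _ _ → refl

    glued-adj : (τ : Autₒᵣ G) → let f = glued (λ _ → perm τ ⟨$⟩ʳ_) in
                ∀ {u v} → Adj (graph (Gs i)) u v → Adj (graph (Gs i)) (f u) (f v)
    glued-adj τ uv = subst₂ (Adj (graph (Gs i)))
      (sym (glued-on (compatible τ) zero u∈i)) (sym (glued-on (compatible τ) zero v∈i))
      (induced-adj (Equivalence.to (preserves-adj τ _ _) (proj₂ (piece⊑ i) _ uv))
        (preserves-piece τ u∈i) (preserves-piece τ v∈i))
      where
        u∈i = nbr-vertex (graph (Gs i)) uv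
        v∈i = adj-vertexʳ (graph (Gs i)) uv

  restrictedAut : Autₒᵣ (Gs i)
  restrictedAut = mkAut (gluedPerm (λ _ → perm σ) (compatible σ) (compatible (inverse σ)))
    (λ v∉i → glued-outside _ λ _ → v∉i)
    (glued-adj σ) (glued-adj (inverse σ))
    (trans (glued-on (compatible σ) zero (source∈ (Gs i))) (fixes-src σ i))
    (trans (glued-on (compatible σ) zero (target∈ (Gs i))) (fixes-tgt σ i))

  restrictedAut-on : ∀ {v} → v ∈ V (Gs i) → perm σ ⟨$⟩ˡ v ≡ perm restrictedAut ⟨$⟩ˡ v
  restrictedAut-on v∈i = sym (glued-on (compatible (inverse σ)) zero v∈i)

-- Orbit representatives of spanning trees

theorem5p4 : ∀ {ℓ : Level} {n m : ℕ} (G : Oriented n) (Gs : Fin (2 + m) → Oriented n) →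
    (∀ i → SeriesParallel (Gs i)) →
    IsSerialComposition G Gs →
    (∀ i → NonSerial (Gs i)) →
    (𝒯 : Fin (2 + m) → Pred (Graph n) ℓ) →
    (∀ i → 𝒯 i ⊆ ST (graph (Gs i))) →
    (∀ i → ExactlyOnePerOrbit (Gs i) (𝒯 i)) →
    Unions 𝒯 ⊆ ST (graph G) × ExactlyOnePerOrbit G (Unions 𝒯)
theorem5p4 {n = n} {m = m} G Gs sp isSerial nonSerial 𝒯 𝒯⊆ST onePerOrbit =
  unions⊆ST , λ A A∈ST → let open Orbit A A∈ST in
    ⋃ᴳ Ts , ((Ts , Ts∈𝒯 , refl , λ _ → refl) , gluedAut , existence) , λ {T} → uniqueness {T}
  where
    open SerialTrees isSerial

    unions⊆ST : Unions 𝒯 ⊆ ST (graph G)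
    unions⊆ST {T} (Ts , Ts∈𝒯 , T≈) = isSpanningTree-resp-≈ (graph G) (⋃ᴳ Ts) T (≈-sym T≈)
      (union-isSpanningTree λ i → 𝒯⊆ST i (Ts∈𝒯 i))

    module Orbit (A : Graph n) (A∈ST : ST (graph G) A) where
      A⊑G = IsSpanningTree.subgraph A∈ST

      representative : ∀ i → _
      representative i = onePerOrbit i (A ⊓ᴳ graph (Gs i)) (piece-isSpanningTree A∈ST i)

      Ts : Fin (2 + m) → Graph n
      Ts i = proj₁ (representative i)

      Ts∈𝒯 : ∀ i → 𝒯 i (Ts i)
      Ts∈𝒯 i = proj₁ (proj₁ (proj₂ (representative i)))

      σs : ∀ i → Autₒᵣ (Gs i)
      σs i = proj₁ (proj₂ (proj₁ (proj₂ (representative i))))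

      open GlueAutomorphisms isSerial σs public

      -- Each representative is the image under `σs i` of the part of `A` in piece `i`, which is the
      -- part of `perm gluedAut • A` there; `decompose` reassembles these parts.
      existence : ⋃ᴳ Ts ≈ perm gluedAut • A
      existence = ≈-trans
        (⋃ᴳ-cong Ts (λ i → (perm gluedAut • A) ⊓ᴳ graph (Gs i)) λ i → ≈-trans
          (proj₂ (proj₂ (proj₁ (proj₂ (representative i)))))
          (≈-sym (•-⊓ (perm gluedAut) (σs i) A (gluedAut-on i))))
        (≈-sym (decompose (perm gluedAut • A) (•-⊑ gluedAut A A⊑G)))

      -- Restricting `σ` to piece `i` puts `Ts′ i` in the orbit of the part of `A` there, so
      -- uniqueness within `𝒯 i` identifies it with `Ts i`.
      uniqueness : ∀ {T} → Unions 𝒯 T × SameOrbit G T A → ⋃ᴳ Ts ≈ T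
      uniqueness {T} ((Ts′ , Ts′∈𝒯 , T≈) , σ , T≈σA) = ≈-trans
        (⋃ᴳ-cong Ts Ts′ λ i → proj₂ (proj₂ (representative i)) (Ts′∈𝒯 i , sameOrbit i))
        (≈-sym T≈)
        where
          sameOrbit : ∀ i → SameOrbit (Gs i) (Ts′ i) (A ⊓ᴳ graph (Gs i))
          sameOrbit i = restrictedAut , ≈-trans
            (≈-sym (union-⊓ (λ j → 𝒯⊆ST j (Ts′∈𝒯 j)) i))
            (≈-trans (⊓ᴳ-congˡ (⋃ᴳ Ts′) (perm σ • A) (graph (Gs i)) (≈-trans (≈-sym T≈) T≈σA))
              (•-⊓ (perm σ) restrictedAut A restrictedAut-on))
            where open RestrictAutomorphism sp isSerial nonSerial σ i
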